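{- Let $\mathcal{V}$ be a strongly irregular variety of a plural type (possibly containing constant symbols). Then for every splitting pair $(\mathcal{V}_1,\mathcal{V}_2)$ in the lattice $\mathbf{L}(\mathcal{V})$ of subvarieties of $\mathcal{V}$ there exists an equational basis of $\mathcal{V}$ for which the splitting identity of $(\mathcal{V}_1,\mathcal{V}_2)$ is regular; that is, there exist an equational basis $\Gamma$ of $\mathcal{V}$ and a regular identity $\rho\approx\sigma$ such that $\Gamma\cup\{\rho\approx\sigma\}$ is an equational basis of $\mathcal{V}_2$.
   Context: A type is plural if it contains at least one operation symbol of arity at least $2$. An identity $\varphi\approx\psi$ is regular if the same variables occur in $\varphi$ and $\psi$. A variety $\mathcal{V}$ is strongly irregular if there is a binary term $f(x,y)$, in which both $x$ and $y$ actually occur, such that $\mathcal{V}\models f(x,y)\approx x$. A pair $(a,b)$ of elements of a lattice $\mathbf{L}$ is a splitting pair if $a\nleq b$ and for every $c\in L$, $a\le c$ or $c\le b$. For a splitting pair $(\mathcal{V}_1,\mathcal{V}_2)$ in $\mathbf{L}(\mathcal{V})$, a splitting identity is a single identity that axiomatizes $\mathcal{V}_2$ relative to $\mathcal{V}$. An equational basis of a variety is a set of identities axiomatizing it. -}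

module Defs where

open import Level using (Level; suc; _⊔_)
open import Data.Fin using (Fin)
open import Data.Fin.Patterns using (0F; 1F)
open import Data.Nat using (ℕ; _≤_)
open import Data.Product using (_×_; _,_; proj₁; proj₂; Σ; ∃-syntax)
open import Data.Sum using (_⊎_; inj₁; inj₂)
open import Function using (_⇔_; _∘_)
open import Relation.Binary using (Setoid)
open import Relation.Binary.Lattice using (Lattice)
open import Relation.Nullary using (¬_)
open import Relation.Unary using (Pred; _∈_; _⊆_; _≐_; _∩_; _∪_)
open import Relation.Unary.Properties using (≐-refl; ≐-sym; ≐-trans)

private
  variable
    c ℓ ℓ₁ ℓ₂ : Level

record Signature (ℓ : Level) : Set (suc ℓ) where
  field
    Op    : Set ℓ
    arity : Op → ℕ

open Signature public

Plural : Signature ℓ → Set ℓ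
Plural S = ∃[ o ] 2 ≤ arity S o

data Term (S : Signature ℓ) (X : Set) : Set ℓ where
  var : X → Term S X
  op  : (o : Op S) → (Fin (arity S o) → Term S X) → Term S X

data _occursIn_ {S : Signature ℓ} {X : Set} (x : X) : Term S X → Set ℓ where
  here  : x occursIn var x
  there : ∀ {o ts} (i : Fin (arity S o)) → x occursIn ts i → x occursIn op o ts

Equation : Signature ℓ → Set → Set ℓ
Equation S X = Term S X × Term S X

-- Identities are written over a fixed countably infinite set of variables.
Identity : Signature ℓ → Set ℓ
Identity S = Equation S ℕ

Regular : {S : Signature ℓ} → Identity S → Set ℓ
Regular (s , t) = ∀ x → x occursIn s ⇔ x occursIn t

-- Algebras have nonempty universes.  They live in the same universe as the
-- signature, which is large enough to contain all (relatively) free algebras.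
record Algebra (S : Signature ℓ) : Set (suc ℓ) where
  field
    setoid : Setoid ℓ ℓ
  open Setoid setoid public using (Carrier; _≈_)
  field
    inhabitant  : Carrier
    interpret   : (o : Op S) → (Fin (arity S o) → Carrier) → Carrier
    interp-cong : ∀ o {us vs} → (∀ i → us i ≈ vs i) →
                  interpret o us ≈ interpret o vs

  ⟦_⟧ : {X : Set} → Term S X → (X → Carrier) → Carrier
  ⟦ var x   ⟧ η = η x
  ⟦ op o ts ⟧ η = interpret o (λ i → ⟦ ts i ⟧ η)

infix 4 _⊨_

_⊨_ : {S : Signature ℓ} {X : Set} → Algebra S → Equation S X → Set ℓ
A ⊨ (s , t) = ∀ η → ⟦ s ⟧ η ≈ ⟦ t ⟧ η
  where open Algebra A

-- Sets of identities are predicates at level `suc ℓ`, rather than `ℓ`, so that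
-- they include the equational theories `Th K` of classes of algebras.
Identities : Signature ℓ → Set (suc (suc ℓ))
Identities {ℓ} S = Pred (Identity S) (suc ℓ)

Class : Signature ℓ → Set (suc (suc ℓ))
Class {ℓ} S = Pred (Algebra S) (suc ℓ)

Mod : {S : Signature ℓ} → Identities S → Class S
Mod Γ A = ∀ ε → ε ∈ Γ → A ⊨ ε

Th : {S : Signature ℓ} → Class S → Identities S
Th K ε = ∀ A → A ∈ K → A ⊨ ε

IsEquationalBasis : {S : Signature ℓ} → Identities S → Class S → Set (suc ℓ)
IsEquationalBasis Γ K = K ≐ Mod Γ

record Variety (S : Signature ℓ) : Set (suc (suc ℓ)) where
  field
    class      : Class S
    equational : ∃[ Γ ] IsEquationalBasis Γ class

open Variety public

-- In the binary term f(x, y), x is 0F and y is 1F.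
StronglyIrregular : {S : Signature ℓ} → Variety S → Set (suc ℓ)
StronglyIrregular {S = S} V =
  Σ (Term S (Fin 2)) λ f →
    0F occursIn f × 1F occursIn f × (∀ A → A ∈ class V → A ⊨ (f , var 0F))

Subvariety : {S : Signature ℓ} → Variety S → Set (suc (suc ℓ))
Subvariety {S = S} V = Σ (Variety S) λ W → class W ⊆ class V

module _ {ℓ} {S : Signature ℓ} where

  -- The variety generated by V ∪ W, axiomatized by their common identities.
  _∨ᵛ_ : Variety S → Variety S → Variety S
  V ∨ᵛ W = record
    { class      = Mod (Th (class V) ∩ Th (class W))
    ; equational = Th (class V) ∩ Th (class W) , ≐-refl
    }

  _∧ᵛ_ : Variety S → Variety S → Variety S
  V ∧ᵛ W with equational V | equational W
  ... | Γ , V⊆ , ⊆V | Δ , W⊆ , ⊆W = record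
    { class      = class V ∩ class W
    ; equational = Γ ∪ Δ
                 , (λ where (A∈V , A∈W) ε (inj₁ ε∈Γ) → V⊆ A∈V ε ε∈Γ
                            (A∈V , A∈W) ε (inj₂ ε∈Δ) → W⊆ A∈W ε ε∈Δ)
                 , (λ A⊨ → ⊆V (λ ε → A⊨ ε ∘ inj₁) , ⊆W (λ ε → A⊨ ε ∘ inj₂))
    }

  ∨ᵛ-upperˡ : ∀ V W → class V ⊆ class (V ∨ᵛ W)
  ∨ᵛ-upperˡ V W {A} A∈V ε ε∈ = proj₁ ε∈ A A∈V

  ∨ᵛ-upperʳ : ∀ V W → class W ⊆ class (V ∨ᵛ W)
  ∨ᵛ-upperʳ V W {A} A∈W ε ε∈ = proj₂ ε∈ A A∈W

  ∨ᵛ-least : ∀ V W U → class V ⊆ class U → class W ⊆ class U →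
             class (V ∨ᵛ W) ⊆ class U
  ∨ᵛ-least V W U V⊆U W⊆U A∈ with equational U
  ... | Γ , U⊆ , ⊆U = ⊆U λ ε ε∈Γ →
    A∈ ε ( (λ _ B∈V → U⊆ (V⊆U B∈V) ε ε∈Γ)
         , (λ _ B∈W → U⊆ (W⊆U B∈W) ε ε∈Γ))

𝐋 : {S : Signature ℓ} → Variety S → Lattice (suc (suc ℓ)) (suc ℓ) (suc ℓ)
𝐋 V = record
  { Carrier   = Subvariety V
  ; _≈_       = λ (W , _) (W′ , _) → class W ≐ class W′
  ; _≤_       = λ (W , _) (W′ , _) → class W ⊆ class W′
  ; _∨_       = λ (W , W⊆V) (W′ , W′⊆V) → W ∨ᵛ W′ , ∨ᵛ-least W W′ V W⊆V W′⊆V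
  ; _∧_       = λ (W , W⊆V) (W′ , _) → W ∧ᵛ W′ , λ A∈ → W⊆V (proj₁ A∈)
  ; isLattice = record
    { isPartialOrder = record
      { isPreorder = record
        { isEquivalence = record
          { refl = ≐-refl ; sym = ≐-sym ; trans = ≐-trans }
        ; reflexive     = proj₁
        ; trans         = λ U⊆W W⊆W′ A∈U → W⊆W′ (U⊆W A∈U)
        }
      ; antisym    = _,_
      }
    ; supremum = λ (W , _) (W′ , _) →
        ∨ᵛ-upperˡ W W′ , ∨ᵛ-upperʳ W W′ , λ (U , _) → ∨ᵛ-least W W′ U
    ; infimum  = λ _ _ →
        proj₁ , proj₂ , λ _ U⊆W U⊆W′ A∈U → U⊆W A∈U , U⊆W′ A∈U
    }
  }

IsSplittingPair : (L : Lattice c ℓ₁ ℓ₂) →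
                  Lattice.Carrier L → Lattice.Carrier L → Set (c ⊔ ℓ₂)
IsSplittingPair L x y = ¬ (x ⊑ y) × (∀ z → x ⊑ z ⊎ z ⊑ y)
  where open Lattice L renaming (_≤_ to _⊑_)

{-# OPTIONS --safe #-}

-- If s ≈ t holds in V₂ but not in V₁, the splitting property forces it to
-- axiomatize V₂ relative to V.  Modulo V, where f(x, y) ≈ x, it is equivalent to
-- f(s, t) ≈ f(t, s); both sides of the latter contain exactly the variables
-- occurring in s or t, since both x and y occur in f.

module Submission where

open import Defs
open import Level using (Level; suc)
open import Axiom.ExcludedMiddle using (ExcludedMiddle)
open import Axiom.DoubleNegationElimination using (em⇒dne)
open import Data.Fin using (Fin)
open import Data.Fin.Patterns using (0F; 1F)
open import Data.Product using (_×_; _,_; proj₁; ∃-syntax)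
open import Data.Sum using (inj₁; inj₂; [_,_]′)
open import Function using (_∘_; _⇔_; mk⇔; module Equivalence)
open import Relation.Binary.PropositionalEquality using (refl)
open import Relation.Binary.Bundles using (Setoid)
open import Relation.Nullary using (¬_; contradiction)
open import Relation.Unary using (_∪_; _∈_; _⊆_; ｛_｝)
open import Relation.Unary.Properties using (≐-refl)
import Relation.Binary.Reasoning.Setoid as SetoidReasoning

private
  variable
    ℓ : Level
    S : Signature ℓ
    X Y : Set

infixl 8 _[_]

_[_] : Term S X → (X → Term S Y) → Term S Y
var x   [ θ ] = θ x
op o ts [ θ ] = op o (λ i → ts i [ θ ])

occursIn-[] : ∀ {x y} {t : Term S X} {θ : X → Term S Y} →
              x occursIn t → y occursIn θ x → y occursIn (t [ θ ])
occursIn-[] here        y∈ = y∈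
occursIn-[] (there i p) y∈ = there i (occursIn-[] p y∈)

occursIn-[]⁻ : ∀ {y} (t : Term S X) {θ : X → Term S Y} →
               y occursIn (t [ θ ]) → ∃[ x ] y occursIn θ x
occursIn-[]⁻ (var x)   y∈          = x , y∈
occursIn-[]⁻ (op o ts) (there i p) = occursIn-[]⁻ (ts i) p

module _ (A : Algebra S) where
  open Algebra A

  ⟦⟧-[] : (t : Term S X) {θ : X → Term S Y} (η : Y → Carrier) →
          ⟦ t [ θ ] ⟧ η ≈ ⟦ t ⟧ (λ x → ⟦ θ x ⟧ η)
  ⟦⟧-[] (var x)   η = Setoid.refl setoid
  ⟦⟧-[] (op o ts) η = interp-cong o (λ i → ⟦⟧-[] (ts i) η)

pair : Term S X → Term S X → Fin 2 → Term S X
pair s t 0F = s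
pair s t 1F = t

regularize : Term S (Fin 2) → Equation S X → Equation S X
regularize f (s , t) = f [ pair s t ] , f [ pair t s ]

module _ (f : Term S (Fin 2)) where

  -- Exchanging `s` and `t` preserves the variables because each argument place of `f` really
  -- occurs: a variable coming from `s` through `0F` on one side reappears through `1F` on the
  -- other, and likewise for `t`.
  regularize-regular : 0F occursIn f → 1F occursIn f →
                       ∀ ε → Regular (regularize f ε)
  regularize-regular 0∈f 1∈f (s , t) x = mk⇔ (swap s t) (swap t s)
    where
    swap : ∀ s t → x occursIn (f [ pair s t ]) → x occursIn (f [ pair t s ])
    swap s t p with occursIn-[]⁻ f p
    ... | 0F , x∈s = occursIn-[] 1∈f x∈s
    ... | 1F , x∈t = occursIn-[] 0∈f x∈t

  -- In `A` both sides collapse to their first arguments, `s` and `t`.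
  regularize-⊨ : (A : Algebra S) → A ⊨ (f , var 0F) →
                 (ε : Equation S X) → A ⊨ ε ⇔ A ⊨ regularize f ε
  regularize-⊨ A f≈x (s , t) = mk⇔
    (λ s≈t η → begin
      ⟦ f [ pair s t ] ⟧ η ≈⟨ absorb s t η ⟩
      ⟦ s ⟧ η              ≈⟨ s≈t η ⟩
      ⟦ t ⟧ η              ≈⟨ absorb t s η ⟨
      ⟦ f [ pair t s ] ⟧ η ∎)
    (λ ρ≈σ η → begin
      ⟦ s ⟧ η              ≈⟨ absorb s t η ⟨
      ⟦ f [ pair s t ] ⟧ η ≈⟨ ρ≈σ η ⟩
      ⟦ f [ pair t s ] ⟧ η ≈⟨ absorb t s η ⟩
      ⟦ t ⟧ η              ∎)
    where
    open Algebra A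
    open SetoidReasoning setoid

    absorb : ∀ s t η → ⟦ f [ pair s t ] ⟧ η ≈ ⟦ s ⟧ η
    absorb s t η = begin
      ⟦ f [ pair s t ] ⟧ η            ≈⟨ ⟦⟧-[] A f η ⟩
      ⟦ f ⟧ (λ i → ⟦ pair s t i ⟧ η)  ≈⟨ f≈x _ ⟩
      ⟦ s ⟧ η                         ∎

-- Classical logic enters here, at level `suc ℓ` because `ε ∈ Th K` quantifies over algebras: it is
-- applied to the existence of `ε` and, for each `ε ∈ Γ`, to `ε ∈ Th K`.
⊈Mod⇒∃ : ExcludedMiddle (suc ℓ) → {S : Signature ℓ}
         {K : Class S} {Γ : Identities S} →
         ¬ (K ⊆ Mod Γ) → ∃[ ε ] ε ∈ Γ × ¬ (ε ∈ Th K)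
⊈Mod⇒∃ em K⊈ = dne λ ∄ε →
  K⊈ λ {A} A∈K ε ε∈Γ → dne (λ ε∉ → ∄ε (ε , ε∈Γ , ε∉)) A A∈K
  where
  dne = λ {P} → em⇒dne em {P}

theorem7 : ∀ {ℓ : Level} → ExcludedMiddle (suc ℓ) →
    (S : Signature ℓ) → Plural S →
    (V : Variety S) → StronglyIrregular V →
    (V₁ V₂ : Subvariety V) → IsSplittingPair (𝐋 V) V₁ V₂ →
    ∃[ Γ ] IsEquationalBasis Γ (class V) ×
    (∃[ ρ ] ∃[ σ ] Regular (ρ , σ) ×
    IsEquationalBasis (Γ ∪ ｛ ρ , σ ｝) (class (proj₁ V₂)))
theorem7 em S _ V (f , 0∈f , 1∈f , f≈x) (V₁ , V₁⊆V) (V₂ , V₂⊆V) (V₁⊈V₂ , split)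
  with equational V | equational V₂
... | Γ , V⊆ , ⊆V | Δ , V₂⊆ , ⊆V₂
  -- If every identity of `Δ` held in `V₁`, then `V₁` would lie below `V₂`, against the splitting
  -- pair; so some member of `Δ` fails there.
  with ε , ε∈Δ , V₁⊭ε ← ⊈Mod⇒∃ em (λ V₁⊆ → V₁⊈V₂ (⊆V₂ ∘ V₁⊆))
  = Γ , (V⊆ , ⊆V) , _ , _ , regularize-regular f 0∈f 1∈f ε , V₂⊆U , U⊆V₂
  where
  ε⇔ : ∀ A → A ∈ class V → A ⊨ ε ⇔ A ⊨ regularize f ε
  ε⇔ A A∈V = regularize-⊨ f A (f≈x A A∈V) ε

  -- The part of `V` cut out by the regularized identity, packaged as an element of the lattice so
  -- that `split` applies to it.
  U : Subvariety V
  U = record { class      = Mod (Γ ∪ ｛ regularize f ε ｝)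
             ; equational = Γ ∪ ｛ regularize f ε ｝ , ≐-refl }
    , λ A∈U → ⊆V (λ δ → A∈U δ ∘ inj₁)

  -- Inside `V` the regularized identity gives back `ε`, which fails in `V₁`. This excludes the
  -- first alternative of `split U`.
  V₁⊈U : ¬ (class V₁ ⊆ class (proj₁ U))
  V₁⊈U V₁⊆U = V₁⊭ε λ A A∈V₁ →
    Equivalence.from (ε⇔ A (V₁⊆V A∈V₁)) (V₁⊆U A∈V₁ _ (inj₂ refl))

  U⊆V₂ : class (proj₁ U) ⊆ class V₂
  U⊆V₂ = [ (λ V₁⊆U → contradiction V₁⊆U V₁⊈U) , (λ U⊆ → U⊆) ]′ (split U)

  V₂⊆U : class V₂ ⊆ class (proj₁ U)
  V₂⊆U     A∈V₂ δ (inj₁ δ∈Γ)  = V⊆ (V₂⊆V A∈V₂) δ δ∈Γ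
  V₂⊆U {A} A∈V₂ _ (inj₂ refl) = Equivalence.to (ε⇔ A (V₂⊆V A∈V₂)) (V₂⊆ A∈V₂ ε ε∈Δ)
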